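{- Let $G$ be a recursively presented group. Then for every finite generating set $S$ of $G$, the skeleton subshift $X_{G,S}$ is effective.
   Context: $G$ is recursively presented if $G\cong\mathbb{F}_S/\langle\langle R\rangle\rangle$ for some finite set $S$ and recursively enumerable set $R$ of words, where $\langle\langle R\rangle\rangle$ is the normal closure. $\mathrm{WP}(G,S)$ is the set of words over $S\cup S^{ -1}$ evaluating to $1_G$. The skeleton subshift is $X_{G,S}=\{x\in(S\cup S^{ -1})^{\mathbb{Z}}: \text{no nonempty finite factor of } x \text{ lies in } \mathrm{WP}(G,S)\}$. A subshift $X\subseteq(S\cup S^{ -1})^{\mathbb{Z}}$ is effective if $X=X_{\mathcal{F}}$ (configurations avoiding all patterns of $\mathcal{F}$) for some decidable set of patterns $\mathcal{F}$. -}

module Defs where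

open import Level using (Level; _⊔_)
open import Data.Nat using (ℕ; zero; suc)
open import Data.Fin using (Fin)
open import Data.Sum using (_⊎_; inj₁; inj₂)
open import Data.Product using (Σ; _×_; _,_; ∃)
open import Data.List using (List; []; _∷_; _++_; reverse; map; foldr)
open import Data.Maybe using (Maybe; just)
open import Data.Bool using (Bool; false)
open import Data.Integer using (ℤ; _+_; 1ℤ)
open import Relation.Binary.PropositionalEquality using (_≡_)
open import Relation.Nullary using (¬_)
open import Function.Bundles using (_⇔_)
open import Algebra.Bundles using (Group)

-- Formal alphabet S ∪ S⁻¹ for a finite set of generators S = Fin n:
-- inj₁ s stands for the letter s, inj₂ s for the letter s⁻¹.

Letter : ℕ → Set
Letter n = Fin n ⊎ Fin n

Word : ℕ → Set
Word n = List (Letter n)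

invLetter : ∀ {n} → Letter n → Letter n
invLetter (inj₁ s) = inj₂ s
invLetter (inj₂ s) = inj₁ s

invWord : ∀ {n} → Word n → Word n
invWord w = reverse (map invLetter w)

module _ {c ℓ} (G : Group c ℓ) where
  open Group G

  evalLetter : ∀ {n} → (Fin n → Carrier) → Letter n → Carrier
  evalLetter gen (inj₁ s) = gen s
  evalLetter gen (inj₂ s) = gen s ⁻¹

  eval : ∀ {n} → (Fin n → Carrier) → Word n → Carrier
  eval gen = foldr (λ a g → evalLetter gen a ∙ g) ε

  Generates : ∀ {n} → (Fin n → Carrier) → Set (c ⊔ ℓ)
  Generates {n} gen = ∀ (g : Carrier) → Σ (Word n) λ w → eval gen w ≈ g

  InWP : ∀ {n} → (Fin n → Carrier) → Word n → Set ℓ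
  InWP gen w = eval gen w ≈ ε

-- Recursively enumerable sets of words: enumerated by a (necessarily
-- computable) Agda function ℕ → Maybe (Word n).

Enumeration : ℕ → Set
Enumeration n = ℕ → Maybe (Word n)

_∈E_ : ∀ {n} → Word n → Enumeration n → Set
w ∈E R = ∃ λ k → R k ≡ just w

-- Equality in the presented group F_T / ⟨⟨R⟩⟩, on representing words:
-- the smallest congruence on words identifying a a⁻¹ with the empty
-- word and each relator r ∈ R with the empty word.  w ≈ₚ v iff w and v
-- represent the same element of F_T / ⟨⟨R⟩⟩ (equivalently w v⁻¹ lies
-- in the normal closure ⟨⟨R⟩⟩ in the free group F_T).

data PresEq {m : ℕ} (R : Enumeration m) : Word m → Word m → Set where
  p-refl   : ∀ {w} → PresEq R w w
  p-sym    : ∀ {w v} → PresEq R w v → PresEq R v w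
  p-trans  : ∀ {u v w} → PresEq R u v → PresEq R v w → PresEq R u w
  p-cancel : ∀ u a v → PresEq R (u ++ (a ∷ invLetter a ∷ v)) (u ++ v)
  p-rel    : ∀ u r v → r ∈E R → PresEq R (u ++ (r ++ v)) (u ++ v)

-- G is recursively presented: G ≅ F_T / ⟨⟨R⟩⟩ for a finite set T and an
-- r.e. set R.  The isomorphism is given by the images τ : T → G of the
-- generators; the induced map F_T/⟨⟨R⟩⟩ → G is a well-defined injective
-- homomorphism (eval w ≈ eval v ⇔ PresEq R w v) and surjective.
RecursivelyPresented : ∀ {c ℓ} → Group c ℓ → Set (c ⊔ ℓ)
RecursivelyPresented G =
  Σ ℕ λ m → Σ (Enumeration m) λ R → Σ (Fin m → Group.Carrier G) λ τ →
    ((w v : Word m) → (Group._≈_ G (eval G τ w) (eval G τ v) ⇔ PresEq R w v))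
    × Generates G τ

Config : ℕ → Set
Config n = ℤ → Letter n

factor : ∀ {n} → Config n → ℤ → ℕ → Word n
factor x i zero      = []
factor x i (suc len) = x i ∷ factor x (i + 1ℤ) len

InSkeleton : ∀ {c ℓ} (G : Group c ℓ) {n} → (Fin n → Group.Carrier G) → Config n → Set ℓ
InSkeleton G gen x = ∀ (i : ℤ) (len : ℕ) → ¬ InWP G gen (factor x i (suc len))

-- X_F for a decidable set of patterns F (given by its Boolean
-- characteristic function; Agda functions are computable)
InXF : ∀ {n} → (Word n → Bool) → Config n → Set
InXF F x = ∀ (i : ℤ) (len : ℕ) → F (factor x i len) ≡ false

Effective : ∀ {n ℓ} → (Config n → Set ℓ) → Set ℓ
Effective {n} X = Σ (Word n → Bool) λ F → ∀ (x : Config n) → (X x ⇔ InXF F x)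

-- The skeleton subshift forbids the nonempty words of WP(G,S), and X_F is
-- effective for every recursively enumerable F = {w | ∃ N. test N w}: forbid u
-- as soon as test N v holds for some N < |u| and some nonempty prefix v of u.
-- A configuration with a factor v ∈ F has factors extending v to the right by
-- arbitrarily much, and one of them is long enough to be forbidden; conversely
-- every forbidden word has a factor in F. WP(G,S) is recursively enumerable:
-- translating S into the generators of the presentation reduces it to the words
-- derivable to [] by inserting and deleting relators, and a search over
-- derivations of bounded size enumerates those.
{-# OPTIONS --safe #-}
module Submission where

open import Defs
open import Data.Nat using (ℕ; zero; suc; _+_; _≤_; _<_; s≤s)
open import Data.Nat.Properties using (anyUpTo?; m≤m+n; m≤n+m; m+n≤o⇒m≤o; m+n≤o⇒n≤o; ≤-refl)
open import Data.Fin using (Fin)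
open import Data.Fin.Properties using () renaming (_≟_ to _≟ᶠ_)
open import Data.Sum using (inj₁; inj₂)
open import Data.Sum.Properties using (≡-dec)
open import Data.Product using (Σ; ∃; -,_; _×_; _,_; proj₁; proj₂)
open import Data.List using (List; []; _∷_; [_]; _++_; map; concatMap; length; take; null; allFin; upTo)
open import Data.Bool.ListAction using (any)
open import Data.List.Relation.Unary.Any using (Any; here; there; satisfied) renaming (map to mapAny)
open import Data.List.Relation.Unary.Any.Properties using (any⁺; any⁻; map⁺; ++⁺ˡ; ++⁺ʳ; concat⁺)
open import Data.List.Membership.Propositional using (_∈_)
open import Data.List.Membership.Propositional.Properties using (∈-map⁺; ∈-++⁺ˡ; ∈-++⁺ʳ; ∈-allFin; ∈-upTo⁺)
open import Data.List.Properties using (unfold-reverse)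
open import Data.Maybe using (Maybe; just; nothing)
open import Data.Bool using (Bool; T; _∨_)
open import Data.Bool.Properties using (T-∨)
open import Data.Integer using () renaming (_+_ to _+ℤ_)
open import Relation.Binary.PropositionalEquality using (_≡_; refl; sym; trans; cong; subst)
open import Relation.Binary.Construct.Closure.ReflexiveTransitive using (Star; ε; _◅_; _◅◅_)
import Relation.Binary.Construct.Closure.ReflexiveTransitive as Star
open import Relation.Binary.Definitions using (DecidableEquality)
open import Relation.Nullary using (¬_; Dec; yes; no; does; contradiction)
open import Relation.Nullary.Decidable using (dec-true; dec-false; T?)
open import Function using (_∘_)
open import Function.Bundles using (_⇔_; mk⇔; Equivalence)
open import Function.Properties.Equivalence using () renaming (trans to ⇔-trans)
open import Algebra.Bundles using (Group)
import Algebra.Properties.Group as GroupProperties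
import Relation.Binary.Reasoning.Setoid as SetoidReasoning

SemiDecidable : ∀ {ℓ} {A : Set} → (A → Set ℓ) → Set ℓ
SemiDecidable {A = A} P = Σ (ℕ → A → Bool) λ test → ∀ a → P a ⇔ (∃ λ N → T (test N a))

semiDecidable-reduce : ∀ {ℓ ℓ′} {A B : Set} {P : A → Set ℓ} {Q : B → Set ℓ′} (f : A → B) →
  (∀ a → P a ⇔ Q (f a)) → SemiDecidable Q → SemiDecidable P
semiDecidable-reduce f P⇔Qf (test , Q⇔test) =
  (λ N a → test N (f a)) , λ a → ⇔-trans (P⇔Qf a) (Q⇔test (f a))

module _ {n : ℕ} (x : Config n) where

  length-factor : ∀ i len → length (factor x i len) ≡ len
  length-factor i zero      = refl
  length-factor i (suc len) = cong suc (length-factor (i +ℤ _) len)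

  take-factor : ∀ {k len} i → k ≤ len → take k (factor x i len) ≡ factor x i k
  take-factor {zero}  i _         = refl
  take-factor {suc k} i (s≤s k≤l) = cong (x i ∷_) (take-factor (i +ℤ _) k≤l)

Avoids : ∀ {n ℓ} → (Word n → Set ℓ) → Config n → Set ℓ
Avoids P x = ∀ i len → ¬ P (factor x i (suc len))

avoids-effective : ∀ {n ℓ} {P : Word n → Set ℓ} → SemiDecidable P → Effective (Avoids P)
avoids-effective {n} {P = P} (test , P⇔test) =
  forbidden , λ x → mk⇔ (avoids⇒inXF x) (inXF⇒avoids x)
  where
  Forbidden : Word n → Set
  Forbidden u = ∃ λ N → N < length u × ∃ λ k → k < length u × T (test N (take (suc k) u))

  forbidden? : ∀ u → Dec (Forbidden u)
  forbidden? u =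
    anyUpTo? (λ N → anyUpTo? (λ k → T? (test N (take (suc k) u))) (length u)) (length u)

  forbidden : Word n → Bool
  forbidden u = does (forbidden? u)

  avoids⇒inXF : ∀ x → Avoids P x → InXF forbidden x
  avoids⇒inXF x avoids i len = dec-false (forbidden? _) λ where
    (N , _ , k , k<len , t) →
      let k<len′ = subst (k <_) (length-factor x i len) k<len
      in avoids i k (subst P (take-factor x i k<len′) (Equivalence.from (P⇔test _) (N , t)))

  inXF⇒avoids : ∀ x → InXF forbidden x → Avoids P x
  inXF⇒avoids x inXF i l p with Equivalence.to (P⇔test _) p
  ... | N , t = contradiction (trans (sym (dec-true (forbidden? _) witness)) (inXF i L)) λ ()
    where
    L = suc (N + l)
    length≡L = sym (length-factor x i L)
    witness : Forbidden (factor x i L)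
    witness = N , subst (N <_) length≡L (s≤s (m≤m+n N l))
            , l , subst (l <_) length≡L (s≤s (m≤n+m l N))
            , subst (T ∘ test N) (sym (take-factor x i (s≤s (m≤n+m l N)))) t

module _ {A : Set} (_≟_ : DecidableEquality A) where

  stripPrefix : (r w : List A) → Maybe (∃ λ v → w ≡ r ++ v)
  stripPrefix []      w       = just (w , refl)
  stripPrefix (a ∷ r) []      = nothing
  stripPrefix (a ∷ r) (b ∷ w) with a ≟ b | stripPrefix r w
  ... | yes refl | just (v , refl) = just (v , refl)
  ... | yes _    | nothing         = nothing
  ... | no _     | _               = nothing

  stripPrefix-++ : ∀ r v → stripPrefix r (r ++ v) ≡ just (v , refl)
  stripPrefix-++ []      v = refl
  stripPrefix-++ (a ∷ r) v with a ≟ a | stripPrefix r (r ++ v) | stripPrefix-++ r v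
  ... | yes refl | _ | refl = refl
  ... | no a≢a   | _ | _    = contradiction refl a≢a

module TrivialWords {m : ℕ} (R : Enumeration m) where

  data Relator : Word m → Set where
    cancellation : ∀ a → Relator (a ∷ invLetter a ∷ [])
    relation     : ∀ {r} → r ∈E R → Relator r

  index : ∀ {r} → Relator r → ℕ
  index (cancellation _)   = 0
  index (relation (k , _)) = k

  data Step : Word m → Word m → Set where
    insert : ∀ u v {r} → Relator r → Step (u ++ v) (u ++ r ++ v)
    delete : ∀ u v {r} → Relator r → Step (u ++ r ++ v) (u ++ v)

  stepIndex : ∀ {w v} → Step w v → ℕ
  stepIndex (insert _ _ ρ) = index ρ
  stepIndex (delete _ _ ρ) = index ρ

  step-sym : ∀ {w v} → Step w v → Step v w
  step-sym (insert u v ρ) = delete u v ρ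
  step-sym (delete u v ρ) = insert u v ρ

  cons-step : ∀ a {w v} → Step w v → Step (a ∷ w) (a ∷ v)
  cons-step a (insert u v ρ) = insert (a ∷ u) v ρ
  cons-step a (delete u v ρ) = delete (a ∷ u) v ρ

  presEq-delete : ∀ u v {r} → Relator r → PresEq R (u ++ r ++ v) (u ++ v)
  presEq-delete u v (cancellation a) = p-cancel u a v
  presEq-delete u v (relation r∈R)   = p-rel u _ v r∈R

  step⇒presEq : ∀ {w v} → Step w v → PresEq R w v
  step⇒presEq (insert u v ρ) = p-sym (presEq-delete u v ρ)
  step⇒presEq (delete u v ρ) = presEq-delete u v ρ

  star⇒presEq : ∀ {w v} → Star Step w v → PresEq R w v
  star⇒presEq = Star.fold (PresEq R) (p-trans ∘ step⇒presEq) p-refl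

  presEq⇒star : ∀ {w v} → PresEq R w v → Star Step w v
  presEq⇒star p-refl              = ε
  presEq⇒star (p-sym p)           = Star.reverse step-sym (presEq⇒star p)
  presEq⇒star (p-trans p q)       = presEq⇒star p ◅◅ presEq⇒star q
  presEq⇒star (p-cancel u a v)    = delete u v (cancellation a) ◅ ε
  presEq⇒star (p-rel u r v r∈R)   = delete u v (relation r∈R) ◅ ε

  -- bounds both the length of a derivation and the relator indices it uses
  size : ∀ {w v} → Star Step w v → ℕ
  size ε       = 0
  size (s ◅ d) = suc (stepIndex s) + size d

  letters : List (Letter m)
  letters = map inj₁ (allFin m) ++ map inj₂ (allFin m)

  ∈-letters : ∀ a → a ∈ letters
  ∈-letters (inj₁ s) = ∈-++⁺ˡ (∈-map⁺ inj₁ (∈-allFin s))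
  ∈-letters (inj₂ s) = ∈-++⁺ʳ (map inj₁ (allFin m)) (∈-map⁺ inj₂ (∈-allFin s))

  relatorsAt : ∀ k {mr} → R k ≡ mr → List (∃ Relator)
  relatorsAt k {just r}  Rk≡r = [ r , relation (k , Rk≡r) ]
  relatorsAt k {nothing} _    = []

  relatorsBelow : ℕ → List (∃ Relator)
  relatorsBelow b =
    map (λ a → -, cancellation a) letters ++ concatMap (λ k → relatorsAt k refl) (upTo b)

  infix 4 _∈₁_
  _∈₁_ : ∀ {B : Word m → Set} → Word m → List (∃ B) → Set
  w ∈₁ xs = Any ((w ≡_) ∘ proj₁) xs

  relatorsAt-complete : ∀ {k r mr} (Rk≡mr : R k ≡ mr) → mr ≡ just r → r ∈₁ relatorsAt k Rk≡mr
  relatorsAt-complete _ refl = here refl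

  relatorsBelow-complete : ∀ {b r} (ρ : Relator r) → index ρ < b → r ∈₁ relatorsBelow b
  relatorsBelow-complete (cancellation a) _ =
    ++⁺ˡ (map⁺ (mapAny (cong (λ a → a ∷ invLetter a ∷ [])) (∈-letters a)))
  relatorsBelow-complete (relation (k , Rk≡r)) k<b =
    ++⁺ʳ _ (concat⁺ (map⁺ (mapAny (λ { refl → relatorsAt-complete refl Rk≡r }) (∈-upTo⁺ k<b))))

  _≟ˡ_ : DecidableEquality (Letter m)
  _≟ˡ_ = ≡-dec _≟ᶠ_ _≟ᶠ_

  stepsAtFront : ∀ {r} → Relator r → (w : Word m) → List (∃ (Step w))
  stepsAtFront {r} ρ w with stripPrefix _≟ˡ_ r w
  ... | just (v , refl) = (r ++ r ++ v , insert [] _ ρ) ∷ (v , delete [] v ρ) ∷ []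
  ... | nothing         = [ r ++ w , insert [] w ρ ]

  frontSteps : ℕ → (w : Word m) → List (∃ (Step w))
  frontSteps b w = concatMap (λ (_ , ρ) → stepsAtFront ρ w) (relatorsBelow b)

  successors : ℕ → (w : Word m) → List (∃ (Step w))
  successors b []      = frontSteps b []
  successors b (a ∷ w) =
    frontSteps b (a ∷ w) ++ map (λ (v , s) → a ∷ v , cons-step a s) (successors b w)

  stepsAtFront-insert : ∀ {r} (ρ : Relator r) w → r ++ w ∈₁ stepsAtFront ρ w
  stepsAtFront-insert {r} ρ w with stripPrefix _≟ˡ_ r w
  ... | just (_ , refl) = here refl
  ... | nothing         = here refl

  stepsAtFront-delete : ∀ {r} (ρ : Relator r) v → v ∈₁ stepsAtFront ρ (r ++ v)
  stepsAtFront-delete {r} ρ v rewrite stripPrefix-++ _≟ˡ_ r v = there (here refl)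

  successors-front : ∀ {b r w v} → r ∈₁ relatorsBelow b →
    (∀ (ρ : Relator r) → v ∈₁ stepsAtFront ρ w) → v ∈₁ successors b w
  successors-front {w = w} found steps =
    front⊆successors w (concat⁺ (map⁺ (mapAny (λ { {_ , ρ} refl → steps ρ }) found)))
    where
    front⊆successors : ∀ {b v} w → v ∈₁ frontSteps b w → v ∈₁ successors b w
    front⊆successors []      = λ p → p
    front⊆successors (_ ∷ _) = ++⁺ˡ

  successors-cons : ∀ {b w v} a → v ∈₁ successors b w → a ∷ v ∈₁ successors b (a ∷ w)
  successors-cons {b} {w} a found = ++⁺ʳ (frontSteps b (a ∷ w)) (map⁺ (mapAny (cong (a ∷_)) found))

  successors-complete : ∀ {b w v} (s : Step w v) → stepIndex s < b → v ∈₁ successors b w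
  successors-complete (insert [] v ρ) i<b =
    successors-front (relatorsBelow-complete ρ i<b) (λ ρ′ → stepsAtFront-insert ρ′ v)
  successors-complete (delete [] v ρ) i<b =
    successors-front (relatorsBelow-complete ρ i<b) (λ ρ′ → stepsAtFront-delete ρ′ v)
  successors-complete (insert (a ∷ u) v ρ) i<b =
    successors-cons a (successors-complete (insert u v ρ) i<b)
  successors-complete (delete (a ∷ u) v ρ) i<b =
    successors-cons a (successors-complete (delete u v ρ) i<b)

  reachesEmpty : (bound fuel : ℕ) → Word m → Bool
  reachesEmpty b zero    w = null w
  reachesEmpty b (suc f) w = null w ∨ any (reachesEmpty b f ∘ proj₁) (successors b w)

  reachesEmpty-sound : ∀ b f w → T (reachesEmpty b f w) → Star Step w []
  reachesEmpty-sound b f       []      _ = ε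
  reachesEmpty-sound b (suc f) (a ∷ w) t
    with (v , s) , t′ ← satisfied (any⁻ _ (successors b (a ∷ w)) t) =
    s ◅ reachesEmpty-sound b f v t′

  reachesEmpty-complete : ∀ {b f w} (d : Star Step w []) →
    size d ≤ b → size d ≤ f → T (reachesEmpty b f w)
  reachesEmpty-complete {f = zero}  ε _ _ = _
  reachesEmpty-complete {f = suc f} ε _ _ = _
  reachesEmpty-complete {f = suc f} {w} (s ◅ d) size≤b (s≤s size≤f) =
    Equivalence.from (T-∨ {null w})
      (inj₂ (any⁺ _ (mapAny (λ { refl → rest }) (successors-complete s index<b))))
    where
    index<b = m+n≤o⇒m≤o (suc (stepIndex s)) size≤b
    rest = reachesEmpty-complete d (m+n≤o⇒n≤o (suc (stepIndex s)) size≤b)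
                                   (m+n≤o⇒n≤o (stepIndex s) size≤f)

  trivialWords-semiDecidable : SemiDecidable (λ w → PresEq R w [])
  trivialWords-semiDecidable = (λ N → reachesEmpty N N) , λ w → mk⇔
    (λ p → let d = presEq⇒star p in size d , reachesEmpty-complete d ≤-refl ≤-refl)
    (λ (N , t) → star⇒presEq (reachesEmpty-sound N N w t))

module _ {c ℓ} (G : Group c ℓ) where
  open Group G renaming (ε to 1ᴳ; refl to ≈-refl; sym to ≈-sym; trans to ≈-trans)
  open GroupProperties G using (ε⁻¹≈ε; ⁻¹-involutive; ⁻¹-anti-homo-∙)
  open SetoidReasoning setoid

  module _ {m : ℕ} (τ : Fin m → Carrier) where

    eval-++ : ∀ u v → eval G τ (u ++ v) ≈ eval G τ u ∙ eval G τ v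
    eval-++ []      v = ≈-sym (identityˡ _)
    eval-++ (a ∷ u) v = begin
      evalLetter G τ a ∙ eval G τ (u ++ v)          ≈⟨ ∙-congˡ (eval-++ u v) ⟩
      evalLetter G τ a ∙ (eval G τ u ∙ eval G τ v)  ≈⟨ ≈-sym (assoc _ _ _) ⟩
      evalLetter G τ a ∙ eval G τ u ∙ eval G τ v    ∎

    evalLetter-invLetter : ∀ a → evalLetter G τ (invLetter a) ≈ evalLetter G τ a ⁻¹
    evalLetter-invLetter (inj₁ s) = ≈-refl
    evalLetter-invLetter (inj₂ s) = ≈-sym (⁻¹-involutive _)

    eval-invWord : ∀ u → eval G τ (invWord u) ≈ eval G τ u ⁻¹
    eval-invWord []      = ≈-sym ε⁻¹≈ε
    eval-invWord (a ∷ u) = begin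
      eval G τ (invWord (a ∷ u))
        ≡⟨ cong (eval G τ) (unfold-reverse (invLetter a) (map invLetter u)) ⟩
      eval G τ (invWord u ++ [ invLetter a ])              ≈⟨ eval-++ (invWord u) _ ⟩
      eval G τ (invWord u) ∙ (evalLetter G τ (invLetter a) ∙ 1ᴳ)
        ≈⟨ ∙-cong (eval-invWord u) (identityʳ _) ⟩
      eval G τ u ⁻¹ ∙ evalLetter G τ (invLetter a)         ≈⟨ ∙-congˡ (evalLetter-invLetter a) ⟩
      eval G τ u ⁻¹ ∙ evalLetter G τ a ⁻¹                  ≈⟨ ≈-sym (⁻¹-anti-homo-∙ _ _) ⟩
      (evalLetter G τ a ∙ eval G τ u) ⁻¹                   ∎

  module _ {m n : ℕ} {τ : Fin m → Carrier} (gen : Fin n → Carrier) (τ-generates : Generates G τ) where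

    translateLetter : Letter n → Word m
    translateLetter (inj₁ s) = proj₁ (τ-generates (gen s))
    translateLetter (inj₂ s) = invWord (proj₁ (τ-generates (gen s)))

    translate : Word n → Word m
    translate = concatMap translateLetter

    eval-translateLetter : ∀ a → eval G τ (translateLetter a) ≈ evalLetter G gen a
    eval-translateLetter (inj₁ s) = proj₂ (τ-generates (gen s))
    eval-translateLetter (inj₂ s) =
      ≈-trans (eval-invWord τ (proj₁ (τ-generates (gen s)))) (⁻¹-cong (proj₂ (τ-generates (gen s))))

    eval-translate : ∀ w → eval G τ (translate w) ≈ eval G gen w
    eval-translate []      = ≈-refl
    eval-translate (a ∷ w) = ≈-trans (eval-++ τ (translateLetter a) (translate w))
                                     (∙-cong (eval-translateLetter a) (eval-translate w))

    inWP⇔translate : ∀ w → InWP G gen w ⇔ InWP G τ (translate w)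
    inWP⇔translate w = mk⇔ (≈-trans (eval-translate w)) (≈-trans (≈-sym (eval-translate w)))

  wordProblem-semiDecidable : RecursivelyPresented G →
    ∀ {n} (gen : Fin n → Carrier) → SemiDecidable (InWP G gen)
  wordProblem-semiDecidable (_ , R , τ , eval≈⇔presEq , τ-generates) gen =
    semiDecidable-reduce (translate gen τ-generates)
      (λ w → ⇔-trans (inWP⇔translate gen τ-generates w) (eval≈⇔presEq _ []))
      (TrivialWords.trivialWords-semiDecidable R)

proposition4 : ∀ {c ℓ} (G : Group c ℓ) → RecursivelyPresented G →
    ∀ (n : ℕ) (gen : Fin n → Group.Carrier G) → Generates G gen →
    Effective (InSkeleton G gen)
proposition4 G presented n gen _ = avoids-effective (wordProblem-semiDecidable G presented gen)
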